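{- Let $n\ge 0$ be an integer and let $q\ge 1$ be an odd integer. Then $$\sum_{k=0}^{n+q}\binom{n+q}{k}\left(\prod_{j=1}^{q}(n+k+j)\right)B_{n+k}=0.$$
   Context: $B_n$ denotes the $n$-th Bernoulli number, $B_n=B_n(0)$, where the Bernoulli polynomials $B_n(x)$ are defined by $\frac{z}{e^{z}-1}e^{xz}=\sum_{n=0}^{\infty}B_n(x)\frac{z^n}{n!}$. In particular $B_0=1$ and $B_1=-\tfrac12$. -}

module Defs where

open import Algebra.Bundles using (module CommutativeRing)
open import Algebra.Definitions.RawSemiring using (product)
open import Data.Fin.Base using (Fin; zero; suc; toℕ)
open import Data.Integer.Base using (+_)
open import Data.Nat.Base as ℕ using (ℕ; zero; suc; _∸_; _!)
open import Data.Nat.Properties using (_!≢0)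
open import Data.Rational.Base using (ℚ; 0ℚ; 1ℚ; ½; _/_; _+_; _*_; _-_; -_; +-*-rawSemiring)
open import Data.Rational.Properties
  using (+-*-commutativeRing; *-identityˡ; *-zeroˡ; +-identityˡ; +-inverseˡ)
open import Data.Vec.Base using (Vec; []; _∷_; head; lookup)
open import Data.Vec.Functional using (Vector)
open import Relation.Binary.PropositionalEquality
  using (_≡_; refl; sym; cong; cong₂; trans; module ≡-Reasoning)

open import Algebra.Definitions.RawSemiring +-*-rawSemiring using (_^_)
open import Algebra.Properties.Semiring.Sum
  (CommutativeRing.semiring +-*-commutativeRing) using (sum-cong-≗)
open import Algebra.Properties.Semiring.Sum
  (CommutativeRing.semiring +-*-commutativeRing) public using (sum⁺-syntax)

∏-syntax : ∀ n → Vector ℕ n → ℕ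
∏-syntax _ = product ℕ.+-*-rawSemiring

infixl 10 ∏-syntax
syntax ∏-syntax n (λ j → x) = ∏[ j < n ] x

fromℕ : ℕ → ℚ
fromℕ m = + m / 1

-- A formal power series over ℚ: f n is the coefficient of zⁿ.
PowerSeries : Set
PowerSeries = ℕ → ℚ

infixl 7 _⊛_
_⊛_ : PowerSeries → PowerSeries → PowerSeries
(f ⊛ g) n = ∑[ i ≤ n ] (f (toℕ i) * g (n ∸ toℕ i))

infixl 6 _⊖_
_⊖_ : PowerSeries → PowerSeries → PowerSeries
(f ⊖ g) n = f n - g n

𝟙 : PowerSeries
𝟙 zero    = 1ℚ
𝟙 (suc _) = 0ℚ

z : PowerSeries
z zero    = 0ℚ
z (suc n) = 𝟙 n

-- exp x is the series e^{xz}; note that 0ℚ ^ 0 = 1ℚ.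
exp : ℚ → PowerSeries
exp x n = x ^ n * ((+ 1 / n !) {{n !≢0}})

-- f / z, for a series f with zero constant term.
_/z : PowerSeries → PowerSeries
(f /z) n = f (suc n)

-- The coefficients of 1 / f in degrees n , … , 1 , 0 (highest first), for a
-- series f with constant term 1, from
--   [zⁿ⁺¹] (1 / f) = - ∑_{i ≤ n} [zⁱ⁺¹] f · [zⁿ⁻ⁱ] (1 / f).
recipCoeffs : PowerSeries → ∀ n → Vec ℚ (suc n)
recipCoeffs f zero    = 1ℚ ∷ []
recipCoeffs f (suc n) =
  (- (∑[ i ≤ n ] (f (suc (toℕ i)) * lookup (recipCoeffs f n) i))) ∷ recipCoeffs f n

recip : PowerSeries → PowerSeries
recip f n = head (recipCoeffs f n)

-- z / (e^z - 1). Numerator and denominator both have zero constant term, so the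
-- quotient of series is the reciprocal of (e^z - 1) / z, whose constant term is 1.
-- See z/[e^z-1]-correct below.
z/[e^z-1] : PowerSeries
z/[e^z-1] = recip ((exp 1ℚ ⊖ 𝟙) /z)

-- B_n(x) is n! times the coefficient of zⁿ in z / (e^z - 1) · e^{xz}.
bernoulliPoly : ℕ → ℚ → ℚ
bernoulliPoly n x = fromℕ (n !) * (z/[e^z-1] ⊛ exp x) n

bernoulli : ℕ → ℚ
bernoulli n = bernoulliPoly n 0ℚ

lookup-recipCoeffs : ∀ f n (i : Fin (suc n)) →
                     lookup (recipCoeffs f n) i ≡ recip f (n ∸ toℕ i)
lookup-recipCoeffs f zero    zero    = refl
lookup-recipCoeffs f (suc n) zero    = refl
lookup-recipCoeffs f (suc n) (suc i) = lookup-recipCoeffs f n i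

recip-correct : ∀ f → f 0 ≡ 1ℚ → ∀ n → (f ⊛ recip f) n ≡ 𝟙 n
recip-correct f f₀≡1 zero    rewrite f₀≡1 = refl
recip-correct f f₀≡1 (suc n) = begin
  f 0 * - S + T  ≡⟨ cong₂ (λ a b → a * - S + b) f₀≡1 T≡S ⟩
  1ℚ * - S + S   ≡⟨ cong (_+ S) (*-identityˡ (- S)) ⟩
  - S + S        ≡⟨ +-inverseˡ S ⟩
  0ℚ             ∎
  where
  open ≡-Reasoning
  S = ∑[ i ≤ n ] (f (suc (toℕ i)) * lookup (recipCoeffs f n) i)
  T = ∑[ i ≤ n ] (f (suc (toℕ i)) * recip f (n ∸ toℕ i))
  T≡S : T ≡ S
  T≡S = sum-cong-≗ {suc n} λ i →
    cong (f (suc (toℕ i)) *_) (sym (lookup-recipCoeffs f n i))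

z/[e^z-1]-correct : ∀ n → ((exp 1ℚ ⊖ 𝟙) ⊛ z/[e^z-1]) n ≡ z n
z/[e^z-1]-correct zero    = refl
z/[e^z-1]-correct (suc n) =
  trans (cong (_+ E⊛Q) (*-zeroˡ (z/[e^z-1] (suc n))))
        (trans (+-identityˡ E⊛Q) (recip-correct ((exp 1ℚ ⊖ 𝟙) /z) refl n))
  where
  E⊛Q = (((exp 1ℚ ⊖ 𝟙) /z) ⊛ z/[e^z-1]) n

bernoulli-0 : bernoulli 0 ≡ 1ℚ
bernoulli-0 = refl

bernoulli-1 : bernoulli 1 ≡ - ½
bernoulli-1 = refl

{-# OPTIONS --safe #-}
module Submission where

-- Let L be the linear functional on polynomials with L(xᵐ) = Bₘ. The sum is
-- L applied to the q-th derivative of xᴺ(1 + x)ᴺ, where N = n + q. The reflection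
-- x ↦ -1 - x fixes xᴺ(1 + x)ᴺ, so for odd q it changes the sign of that derivative;
-- but L is invariant under it, because ∑ₖ C(m,k) Bₖ = (-1)ᵐ Bₘ. Hence the sum
-- equals its own negative.
--
-- Functionals are represented by their moments b, so that L(xⁱ(1 + x)ʲ) is
-- binomialSum (λ k → b (i + k)) j.

open import Defs
open import Data.Fin.Base using (toℕ)
open import Data.Nat.Base using (ℕ; suc; _+_; _≤_)
open import Data.Nat.Combinatorics using (_C_)
open import Data.Nat.Divisibility using (_∤_)
open import Data.Rational.Base using (0ℚ; _*_)
open import Relation.Binary.PropositionalEquality using (_≡_)

open import Algebra.Bundles using (module CommutativeRing)
open import Data.Empty using (⊥-elim)
open import Data.Fin.Base using (Fin; zero; suc; opposite)
open import Data.Fin.Permutation using (reverse)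
open import Data.Fin.Properties using (toℕ-inject₁; toℕ-fromℕ; opposite-prop; toℕ≤pred[n])
open import Data.Integer.Base as ℤ using (+_)
import Data.Integer.Properties as ℤ
open import Data.Nat.Base using (zero; _∸_; _!; _<_; s≤s; z≤n; NonZero) renaming (_*_ to _*ℕ_)
open import Data.Nat.Combinatorics
  using (nCk≡n!/k![n-k]!; k![n∸k]!∣n!; nCk+nC[k+1]≡[n+1]C[k+1]; nCn≡1; k>n⇒nCk≡0; nCk≡nC[n∸k]; nC1≡n)
open import Data.Nat.Divisibility using (divides; ∣m∣n⇒∣m+n; ∣-refl)
open import Data.Nat.DivMod using (m/n*n≡m)
open import Data.Nat.Induction using (<-rec)
import Data.Nat.Properties as ℕ
import Data.Nat.Solver as ℕ
open import Data.Rational.Base using (ℚ; 1ℚ; _/_; +-*-rawSemiring)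
  renaming (_+_ to _+ℚ_; -_ to -ℚ_)
import Data.Rational.Properties as ℚ
import Data.Rational.Solver as ℚ
open import Data.Rational.Unnormalised.Base using (mkℚᵘ; *≡*)
import Data.Rational.Unnormalised.Properties as ℚᵘ
open import Function.Base using (_∘_)
open import Relation.Binary.PropositionalEquality
  using (refl; sym; trans; cong; cong₂; subst; module ≡-Reasoning)

open import Algebra.Definitions.RawSemiring +-*-rawSemiring using (_^_)
open import Algebra.Properties.Ring (CommutativeRing.ring ℚ.+-*-commutativeRing)
  using (-‿involutive; +-identityˡ-unique)
open import Algebra.Properties.Semiring.Sum (CommutativeRing.semiring ℚ.+-*-commutativeRing)
  using (sum; sum-cong-≗; sum-init-last; sum-replicate-zero; ∑-distrib-+; *-distribˡ-sum; sum-permute)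
open ≡-Reasoning

-- The embedding of ℕ into ℚ.

fromℕ-+ : ∀ m n → fromℕ (m + n) ≡ fromℕ m +ℚ fromℕ n
-- `+ m / 1` is normalised by a gcd that does not reduce for a variable m, so this law and the next
-- two are checked on unnormalised fractions.
fromℕ-+ m n = ℚ.toℚᵘ-injective (ℚᵘ.≃-trans (ℚ.toℚᵘ-fromℚᵘ (mkℚᵘ (+ (m + n)) 0))
  (ℚᵘ.≃-trans (*≡* (cong (ℤ._* + 1) (cong₂ ℤ._+_ (sym (ℤ.*-identityʳ (+ m))) (sym (ℤ.*-identityʳ (+ n))))))
  (ℚᵘ.≃-sym (ℚᵘ.≃-trans (ℚ.toℚᵘ-homo-+ (fromℕ m) (fromℕ n))
    (ℚᵘ.+-cong (ℚ.toℚᵘ-fromℚᵘ (mkℚᵘ (+ m) 0)) (ℚ.toℚᵘ-fromℚᵘ (mkℚᵘ (+ n) 0)))))))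

fromℕ-* : ∀ m n → fromℕ (m *ℕ n) ≡ fromℕ m * fromℕ n
fromℕ-* m n = ℚ.toℚᵘ-injective (ℚᵘ.≃-trans (ℚ.toℚᵘ-fromℚᵘ (mkℚᵘ (+ (m *ℕ n)) 0))
  (ℚᵘ.≃-trans (*≡* (cong (ℤ._* + 1) (ℤ.pos-* m n)))
  (ℚᵘ.≃-sym (ℚᵘ.≃-trans (ℚ.toℚᵘ-homo-* (fromℕ m) (fromℕ n))
    (ℚᵘ.*-cong (ℚ.toℚᵘ-fromℚᵘ (mkℚᵘ (+ m) 0)) (ℚ.toℚᵘ-fromℚᵘ (mkℚᵘ (+ n) 0)))))))

fromℕ-inverseʳ : ∀ n .{{_ : NonZero n}} → fromℕ n * (+ 1 / n) ≡ 1ℚ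
fromℕ-inverseʳ (suc n) = ℚ.toℚᵘ-injective (ℚᵘ.≃-trans (ℚ.toℚᵘ-homo-* (fromℕ (suc n)) (+ 1 / suc n))
  (ℚᵘ.≃-trans (ℚᵘ.*-cong (ℚ.toℚᵘ-fromℚᵘ (mkℚᵘ (+ suc n) 0)) (ℚ.toℚᵘ-fromℚᵘ (mkℚᵘ (+ 1) n)))
  (*≡* (trans (ℤ.*-identityʳ _) (trans (ℤ.*-identityʳ _)
    (sym (trans (ℤ.*-identityˡ _) (cong +_ (ℕ.*-identityˡ (suc n))))))))))

fromℕ-cancelˡ : ∀ n .{{_ : NonZero n}} x → fromℕ n * x ≡ 0ℚ → x ≡ 0ℚ
fromℕ-cancelˡ n x nx≡0 = begin
  x                            ≡⟨ ℚ.*-identityˡ x ⟨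
  1ℚ * x                       ≡⟨ cong (_* x) (fromℕ-inverseʳ n) ⟨
  fromℕ n * (+ 1 / n) * x      ≡⟨ solve 3 (λ a b c → a :* b :* c := b :* (a :* c)) refl (fromℕ n) (+ 1 / n) x ⟩
  (+ 1 / n) * (fromℕ n * x)    ≡⟨ cong ((+ 1 / n) *_) nx≡0 ⟩
  (+ 1 / n) * 0ℚ               ≡⟨ ℚ.*-zeroʳ (+ 1 / n) ⟩
  0ℚ                           ∎
  where open ℚ.+-*-Solver

-- Binomial coefficients and factorials.

nCk*k![n∸k]!≡n! : ∀ {n k} → k ≤ n → (n C k) *ℕ (k ! *ℕ (n ∸ k) !) ≡ n !
nCk*k![n∸k]!≡n! {n} {k} k≤n = trans (cong (_*ℕ (k ! *ℕ (n ∸ k) !)) (nCk≡n!/k![n-k]! k≤n))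
                                     (m/n*n≡m {{ℕ._!*_!≢0 k (n ∸ k)}} (k![n∸k]!∣n! k≤n))

-- After multiplication by k!(n - k)! both sides become (n + 1)!, and that factor is nonzero.
[n+1]C[k+1]*[k+1] : ∀ {n k} → k ≤ n → (suc n C suc k) *ℕ suc k ≡ suc n *ℕ (n C k)
[n+1]C[k+1]*[k+1] {n} {k} k≤n = ℕ.*-cancelʳ-≡ _ _ d {{ℕ._!*_!≢0 k (n ∸ k)}} (begin
  (suc n C suc k) *ℕ suc k *ℕ d
    ≡⟨ solve 4 (λ a b c e → a :* b :* (c :* e) := a :* (b :* c :* e)) refl
         (suc n C suc k) (suc k) (k !) ((n ∸ k) !) ⟩
  (suc n C suc k) *ℕ (suc k ! *ℕ (n ∸ k) !) ≡⟨ nCk*k![n∸k]!≡n! (s≤s k≤n) ⟩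
  suc n *ℕ n !                            ≡⟨ cong (suc n *ℕ_) (nCk*k![n∸k]!≡n! k≤n) ⟨
  suc n *ℕ ((n C k) *ℕ d)                 ≡⟨ ℕ.*-assoc (suc n) (n C k) d ⟨
  suc n *ℕ (n C k) *ℕ d                   ∎)
  where
  open ℕ.+-*-Solver
  d = k ! *ℕ (n ∸ k) !

-- Finite sums and Cauchy products.

∑-zero : ∀ n (f : Fin n → ℚ) → (∀ i → f i ≡ 0ℚ) → sum f ≡ 0ℚ
∑-zero n f f≗0 = trans (sum-cong-≗ f≗0) (sum-replicate-zero n)

∑-last : ∀ n (f : ℕ → ℚ) → ∑[ i ≤ suc n ] f (toℕ i) ≡ ∑[ i ≤ n ] f (toℕ i) +ℚ f (suc n)
∑-last n f = trans (sum-init-last {suc n} (λ i → f (toℕ i)))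
  (cong₂ _+ℚ_ (sum-cong-≗ {suc n} λ i → cong f (toℕ-inject₁ i)) (cong f (toℕ-fromℕ (suc n))))

⊛-comm : ∀ f g n → (f ⊛ g) n ≡ (g ⊛ f) n
⊛-comm f g n = trans (sum-permute {suc n} {suc n} (λ i → f (toℕ i) * g (n ∸ toℕ i)) reverse)
  (sum-cong-≗ {suc n} λ i → begin
  f (toℕ (opposite i)) * g (n ∸ toℕ (opposite i))
    ≡⟨ cong (λ j → f j * g (n ∸ j)) (opposite-prop i) ⟩
  f (n ∸ toℕ i) * g (n ∸ (n ∸ toℕ i))
    ≡⟨ cong (λ j → f (n ∸ toℕ i) * g j) (ℕ.m∸[m∸n]≡n (toℕ≤pred[n] i)) ⟩
  f (n ∸ toℕ i) * g (toℕ i)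
    ≡⟨ ℚ.*-comm (f (n ∸ toℕ i)) (g (toℕ i)) ⟩
  g (toℕ i) * f (n ∸ toℕ i) ∎)

⊛-identityˡ : ∀ f n → (𝟙 ⊛ f) n ≡ f n
⊛-identityˡ f n = trans (cong₂ _+ℚ_ (ℚ.*-identityˡ (f n))
  (∑-zero n (λ i → 𝟙 (suc (toℕ i)) * f (n ∸ suc (toℕ i))) λ i → ℚ.*-zeroˡ (f (n ∸ suc (toℕ i)))))
  (ℚ.+-identityʳ (f n))

⊛-congʳ : ∀ {f g} h → (∀ n → f n ≡ g n) → ∀ n → (f ⊛ h) n ≡ (g ⊛ h) n
⊛-congʳ h f≗g n = sum-cong-≗ {suc n} λ i → cong (_* h (n ∸ toℕ i)) (f≗g (toℕ i))

[f⊖g]⊛h+g⊛h≡f⊛h : ∀ h f g n → ((f ⊖ g) ⊛ h) n +ℚ (g ⊛ h) n ≡ (f ⊛ h) n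
[f⊖g]⊛h+g⊛h≡f⊛h h f g n = trans
  (sym (∑-distrib-+ {suc n} (λ i → (f ⊖ g) (toℕ i) * h (n ∸ toℕ i)) (λ i → g (toℕ i) * h (n ∸ toℕ i))))
  (sum-cong-≗ {suc n} λ i → solve 3 (λ a b c → (a :- b) :* c :+ b :* c := a :* c) refl (f (toℕ i)) (g (toℕ i)) (h (n ∸ toℕ i)))
  where open ℚ.+-*-Solver

-- The binomial transform.

binomialSum : (ℕ → ℚ) → ℕ → ℚ
binomialSum f n = ∑[ k ≤ n ] (fromℕ (n C toℕ k) * f (toℕ k))

binomialSum-cong : ∀ f g → (∀ k → f k ≡ g k) → ∀ n → binomialSum f n ≡ binomialSum g n
binomialSum-cong f g f≗g n = sum-cong-≗ {suc n} λ k → cong (fromℕ (n C toℕ k) *_) (f≗g (toℕ k))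

binomialSum-+ : ∀ f g n → binomialSum (λ k → f k +ℚ g k) n ≡ binomialSum f n +ℚ binomialSum g n
binomialSum-+ f g n = trans
  (sum-cong-≗ {suc n} λ k → ℚ.*-distribˡ-+ (fromℕ (n C toℕ k)) (f (toℕ k)) (g (toℕ k)))
  (∑-distrib-+ {suc n} (λ k → fromℕ (n C toℕ k) * f (toℕ k)) (λ k → fromℕ (n C toℕ k) * g (toℕ k)))

binomialSum-*ˡ : ∀ c f n → binomialSum (λ k → c * f k) n ≡ c * binomialSum f n
binomialSum-*ˡ c f n = trans
  (sum-cong-≗ {suc n} λ k → solve 3 (λ a b e → a :* (b :* e) := b :* (a :* e)) refl (fromℕ (n C toℕ k)) c (f (toℕ k)))
  (sym (*-distribˡ-sum {suc n} c (λ k → fromℕ (n C toℕ k) * f (toℕ k))))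
  where open ℚ.+-*-Solver

binomialSum-0 : ∀ f → binomialSum f 0 ≡ f 0
binomialSum-0 f = trans (ℚ.+-identityʳ (1ℚ * f 0)) (ℚ.*-identityˡ (f 0))

-- The functional with moments f, applied to (1 + x)ⁿ⁺¹ = (1 + x)ⁿ + x(1 + x)ⁿ. On coefficients this
-- is Pascal's rule.
binomialSum-suc : ∀ f n → binomialSum f (suc n) ≡ binomialSum f n +ℚ binomialSum (f ∘ suc) n
binomialSum-suc f n = begin
  c₀ +ℚ ∑[ k ≤ n ] (fromℕ (suc n C suc (toℕ k)) * f (suc (toℕ k)))
    ≡⟨ cong (c₀ +ℚ_) (trans (sum-cong-≗ {suc n} λ k → pascal (toℕ k))
         (∑-distrib-+ {suc n} (λ k → fromℕ (n C toℕ k) * f (suc (toℕ k)))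
                           (λ k → fromℕ (n C suc (toℕ k)) * f (suc (toℕ k))))) ⟩
  c₀ +ℚ (binomialSum (f ∘ suc) n +ℚ S)
    ≡⟨ solve 3 (λ a b c → a :+ (b :+ c) := (a :+ c) :+ b) refl c₀ (binomialSum (f ∘ suc) n) S ⟩
  (c₀ +ℚ S) +ℚ binomialSum (f ∘ suc) n
    -- `c₀ +ℚ S` is row n of Pascal's triangle summed up to k = n + 1, one place too far; the extra
    -- coefficient C(n, n + 1) is zero.
    ≡⟨ cong (_+ℚ binomialSum (f ∘ suc) n) (∑-last n (λ k → fromℕ (n C k) * f k)) ⟩
  (binomialSum f n +ℚ fromℕ (n C suc n) * f (suc n)) +ℚ binomialSum (f ∘ suc) n
    ≡⟨ cong (λ x → (binomialSum f n +ℚ fromℕ x * f (suc n)) +ℚ binomialSum (f ∘ suc) n) (k>n⇒nCk≡0 (ℕ.n<1+n n)) ⟩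
  (binomialSum f n +ℚ 0ℚ * f (suc n)) +ℚ binomialSum (f ∘ suc) n
    ≡⟨ solve 3 (λ a b c → (a :+ con 0ℚ :* b) :+ c := a :+ c) refl (binomialSum f n) (f (suc n)) (binomialSum (f ∘ suc) n) ⟩
  binomialSum f n +ℚ binomialSum (f ∘ suc) n ∎
  where
  open ℚ.+-*-Solver
  c₀ = fromℕ 1 * f 0
  S = ∑[ k ≤ n ] (fromℕ (n C suc (toℕ k)) * f (suc (toℕ k)))
  pascal : ∀ k → fromℕ (suc n C suc k) * f (suc k) ≡ fromℕ (n C k) * f (suc k) +ℚ fromℕ (n C suc k) * f (suc k)
  pascal k = trans (cong (λ c → fromℕ c * f (suc k)) (sym (nCk+nC[k+1]≡[n+1]C[k+1] n k)))
    (trans (cong (_* f (suc k)) (fromℕ-+ (n C k) (n C suc k)))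
           (ℚ.*-distribʳ-+ (f (suc k)) (fromℕ (n C k)) (fromℕ (n C suc k))))

-- In binomialSum e (n + 1) = e (n + 1) the top terms cancel, and by induction
-- all that is left is (n + 1) · e n = 0.
binomialSum-fixed⇒0 : ∀ e → (∀ n → binomialSum e n ≡ e n) → ∀ n → e n ≡ 0ℚ
binomialSum-fixed⇒0 e fixed = <-rec _ λ n e<n≡0 → fromℕ-cancelˡ (suc n) (e n) (begin
  fromℕ (suc n) * e n       ≡⟨ cong (λ c → fromℕ c * e n) ([n+1]Cn≡n+1 n) ⟨
  fromℕ (suc n C n) * e n   ≡⟨ below-n n e<n≡0 ⟨
  belowTop n                ≡⟨ +-identityˡ-unique (belowTop n) (e (suc n)) (belowTop-cancels n) ⟩
  0ℚ                        ∎)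
  where
  belowTop : ℕ → ℚ
  belowTop n = ∑[ k ≤ n ] (fromℕ (suc n C toℕ k) * e (toℕ k))

  [n+1]Cn≡n+1 : ∀ n → suc n C n ≡ suc n
  [n+1]Cn≡n+1 n = trans (sym (nCk≡nC[n∸k] {1} {suc n} (s≤s z≤n))) (nC1≡n (suc n))

  belowTop-cancels : ∀ n → belowTop n +ℚ e (suc n) ≡ e (suc n)
  belowTop-cancels n = begin
    belowTop n +ℚ e (suc n)
      ≡⟨ cong (belowTop n +ℚ_) (ℚ.*-identityˡ (e (suc n))) ⟨
    belowTop n +ℚ 1ℚ * e (suc n)
      ≡⟨ cong (λ c → belowTop n +ℚ fromℕ c * e (suc n)) (nCn≡1 (suc n)) ⟨
    belowTop n +ℚ fromℕ (suc n C suc n) * e (suc n)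
      ≡⟨ ∑-last n (λ k → fromℕ (suc n C k) * e k) ⟨
    binomialSum e (suc n)
      ≡⟨ fixed (suc n) ⟩
    e (suc n) ∎

  below-n : ∀ n → (∀ {k} → k < n → e k ≡ 0ℚ) → belowTop n ≡ fromℕ (suc n C n) * e n
  below-n zero    _     = ℚ.+-identityʳ (1ℚ * e 0)
  below-n (suc m) e<n≡0 = begin
    belowTop (suc m)   ≡⟨ ∑-last m (λ k → fromℕ (suc (suc m) C k) * e k) ⟩
    S +ℚ t             ≡⟨ cong (_+ℚ t) (∑-zero (suc m) (λ k → fromℕ (suc (suc m) C toℕ k) * e (toℕ k)) λ k →
                            trans (cong (fromℕ (suc (suc m) C toℕ k) *_) (e<n≡0 (s≤s (toℕ≤pred[n] k))))
                                  (ℚ.*-zeroʳ (fromℕ (suc (suc m) C toℕ k)))) ⟩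
    0ℚ +ℚ t            ≡⟨ ℚ.+-identityˡ t ⟩
    t                  ∎
    where
    S = ∑[ k ≤ m ] (fromℕ (suc (suc m) C toℕ k) * e (toℕ k))
    t = fromℕ (suc (suc m) C suc m) * e (suc m)

-- The reflection x ↦ -1 - x and differentiation, acting on functionals.

sign : ℕ → ℚ
sign zero    = 1ℚ
sign (suc n) = -ℚ sign n

sign-square : ∀ n → sign (n + n) ≡ 1ℚ
sign-square zero    = refl
sign-square (suc n) = trans (cong (λ m → -ℚ sign m) (ℕ.+-suc n n)) (trans (-‿involutive (sign (n + n))) (sign-square n))

sign-odd : ∀ n → 2 ∤ n → sign n ≡ -ℚ 1ℚ
sign-odd 0 2∤0             = ⊥-elim (2∤0 (divides 0 refl))
sign-odd 1 _               = refl
sign-odd (suc (suc n)) 2∤n = trans (-‿involutive (sign n)) (sign-odd n λ 2∣n → 2∤n (∣m∣n⇒∣m+n ∣-refl 2∣n))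

-- If c are the moments of f ↦ L(f(-1 - x)), where b are those of L, this says that
-- xⁱ(1 + x)ʲ is sent to (-1)ⁱ⁺ʲ L(xʲ(1 + x)ⁱ).
binomialSum-transpose : ∀ b c → (∀ n → c n ≡ sign n * binomialSum b n) →
  ∀ i j → binomialSum (λ k → c (i + k)) j ≡ sign (i + j) * binomialSum (λ k → b (j + k)) i
binomialSum-transpose b c c≗ i zero = begin
  binomialSum (λ k → c (i + k)) 0          ≡⟨ binomialSum-0 (λ k → c (i + k)) ⟩
  c (i + 0)                                ≡⟨ c≗ (i + 0) ⟩
  sign (i + 0) * binomialSum b (i + 0)     ≡⟨ cong (λ m → sign (i + 0) * binomialSum b m) (ℕ.+-identityʳ i) ⟩
  sign (i + 0) * binomialSum b i           ∎
binomialSum-transpose b c c≗ i (suc j) = begin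
  binomialSum (λ k → c (i + k)) (suc j)
    ≡⟨ binomialSum-suc (λ k → c (i + k)) j ⟩
  binomialSum (λ k → c (i + k)) j +ℚ binomialSum (λ k → c (i + suc k)) j
    ≡⟨ cong (binomialSum (λ k → c (i + k)) j +ℚ_)
         (binomialSum-cong (λ k → c (i + suc k)) (λ k → c (suc i + k)) (λ k → cong c (ℕ.+-suc i k)) j) ⟩
  binomialSum (λ k → c (i + k)) j +ℚ binomialSum (λ k → c (suc i + k)) j
    -- The induction on j keeps i general, because xⁱ(1 + x)ʲ⁺¹ splits into terms with exponents i
    -- and i + 1 of x. Their signs are opposite, so expanding the second by the same rule cancels x
    -- and leaves y.
    ≡⟨ cong₂ _+ℚ_ (binomialSum-transpose b c c≗ i j) (binomialSum-transpose b c c≗ (suc i) j) ⟩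
  s * x +ℚ -ℚ s * binomialSum (λ k → b (j + k)) (suc i)
    ≡⟨ cong (λ t → s * x +ℚ -ℚ s * t) (binomialSum-suc (λ k → b (j + k)) i) ⟩
  s * x +ℚ -ℚ s * (x +ℚ y)
    ≡⟨ solve 3 (λ s x y → s :* x :+ :- s :* (x :+ y) := :- s :* y) refl s x y ⟩
  -ℚ s * y
    ≡⟨ cong₂ _*_ (cong sign (sym (ℕ.+-suc i j)))
         (binomialSum-cong (λ k → b (j + suc k)) (λ k → b (suc j + k)) (λ k → cong b (ℕ.+-suc j k)) i) ⟩
  sign (i + suc j) * binomialSum (λ k → b (suc j + k)) i ∎
  where
  open ℚ.+-*-Solver
  s = sign (i + j)
  x = binomialSum (λ k → b (j + k)) i
  y = binomialSum (λ k → b (j + suc k)) i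

-- The functional with moments b is multiplied by ε under x ↦ -1 - x.
SelfDual : ℚ → (ℕ → ℚ) → Set
SelfDual ε b = ∀ n → binomialSum b n ≡ ε * (sign n * b n)

-- The moments of f ↦ L(f′).
mulExponent : (ℕ → ℚ) → ℕ → ℚ
mulExponent b zero    = 0ℚ
mulExponent b (suc n) = fromℕ (suc n) * b n

-- The derivative of (1 + x)ⁿ⁺¹ is (n + 1)(1 + x)ⁿ. On coefficients the term k = 0 vanishes and the
-- others follow from C(n+1, k+1)(k + 1) = (n + 1)C(n, k).
binomialSum-mulExponent : ∀ b n → binomialSum (mulExponent b) (suc n) ≡ fromℕ (suc n) * binomialSum b n
binomialSum-mulExponent b n = begin
  fromℕ 1 * 0ℚ +ℚ S
    ≡⟨ ℚ.+-identityˡ S ⟩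
  S
    ≡⟨ sum-cong-≗ {suc n} (λ k → absorb (toℕ k) (toℕ≤pred[n] k)) ⟩
  ∑[ k ≤ n ] (fromℕ (suc n) * (fromℕ (n C toℕ k) * b (toℕ k)))
    ≡⟨ *-distribˡ-sum {suc n} (fromℕ (suc n)) (λ k → fromℕ (n C toℕ k) * b (toℕ k)) ⟨
  fromℕ (suc n) * binomialSum b n ∎
  where
  S = ∑[ k ≤ n ] (fromℕ (suc n C suc (toℕ k)) * (fromℕ (suc (toℕ k)) * b (toℕ k)))
  absorb : ∀ k → k ≤ n → fromℕ (suc n C suc k) * (fromℕ (suc k) * b k) ≡ fromℕ (suc n) * (fromℕ (n C k) * b k)
  absorb k k≤n = begin
    fromℕ (suc n C suc k) * (fromℕ (suc k) * b k) ≡⟨ ℚ.*-assoc (fromℕ (suc n C suc k)) (fromℕ (suc k)) (b k) ⟨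
    fromℕ (suc n C suc k) * fromℕ (suc k) * b k   ≡⟨ cong (_* b k) (fromℕ-* (suc n C suc k) (suc k)) ⟨
    fromℕ ((suc n C suc k) *ℕ suc k) * b k        ≡⟨ cong (λ m → fromℕ m * b k) ([n+1]C[k+1]*[k+1] k≤n) ⟩
    fromℕ (suc n *ℕ (n C k)) * b k                ≡⟨ cong (_* b k) (fromℕ-* (suc n) (n C k)) ⟩
    fromℕ (suc n) * fromℕ (n C k) * b k           ≡⟨ ℚ.*-assoc (fromℕ (suc n)) (fromℕ (n C k)) (b k) ⟩
    fromℕ (suc n) * (fromℕ (n C k) * b k)         ∎

-- The chain rule: x ↦ -1 - x has derivative -1, so differentiating flips the sign. On moments the
-- flip is the step from `sign n` to `sign (suc n)`.
mulExponent-selfDual : ∀ ε b → SelfDual ε b → SelfDual (-ℚ ε) (mulExponent b)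
mulExponent-selfDual ε b dual zero = trans (binomialSum-0 (mulExponent b))
  (solve 1 (λ ε → con 0ℚ := :- ε :* (con 1ℚ :* con 0ℚ)) refl ε)
  where open ℚ.+-*-Solver
mulExponent-selfDual ε b dual (suc n) = begin
  binomialSum (mulExponent b) (suc n)    ≡⟨ binomialSum-mulExponent b n ⟩
  fromℕ (suc n) * binomialSum b n        ≡⟨ cong (fromℕ (suc n) *_) (dual n) ⟩
  fromℕ (suc n) * (ε * (sign n * b n))
    ≡⟨ solve 4 (λ m ε s x → m :* (ε :* (s :* x)) := :- ε :* (:- s :* (m :* x))) refl (fromℕ (suc n)) ε (sign n) (b n) ⟩
  -ℚ ε * (-ℚ sign n * (fromℕ (suc n) * b n)) ∎
  where open ℚ.+-*-Solver

-- The moments of f ↦ L(f⁽q⁾), where b are those of L. The recursion changes b, so inductions on q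
-- must keep b general.
mulExponents : ℕ → (ℕ → ℚ) → ℕ → ℚ
mulExponents zero    b = b
mulExponents (suc q) b = mulExponents q (mulExponent b)

mulExponents-selfDual : ∀ q ε b → SelfDual ε b → SelfDual (sign q * ε) (mulExponents q b)
mulExponents-selfDual zero    ε b dual = subst (λ δ → SelfDual δ b) (sym (ℚ.*-identityˡ ε)) dual
mulExponents-selfDual (suc q) ε b dual =
  subst (λ δ → SelfDual δ (mulExponents (suc q) b)) (solve 2 (λ s ε → s :* :- ε := :- s :* ε) refl (sign q) ε)
    (mulExponents-selfDual q (-ℚ ε) (mulExponent b) (mulExponent-selfDual ε b dual))
  where open ℚ.+-*-Solver

∏-cong : ∀ q {f g : Fin q → ℕ} → (∀ j → f j ≡ g j) → ∏[ j < q ] f j ≡ ∏[ j < q ] g j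
∏-cong zero    f≗g = refl
∏-cong (suc q) f≗g = cong₂ _*ℕ_ (f≗g zero) (∏-cong q (f≗g ∘ suc))

-- The q-th derivative of xᵐ⁺q is (m + 1)⋯(m + q)xᵐ. Indexing by `m + q` avoids truncated
-- subtraction.
mulExponents-∏ : ∀ q b m → mulExponents q b (m + q) ≡ fromℕ (∏[ j < q ] (m + suc (toℕ j))) * b m
mulExponents-∏ zero    b m = trans (cong b (ℕ.+-identityʳ m)) (sym (ℚ.*-identityˡ (b m)))
mulExponents-∏ (suc q) b m = begin
  mulExponents q (mulExponent b) (m + suc q)   ≡⟨ cong (mulExponents q (mulExponent b)) (ℕ.+-suc m q) ⟩
  mulExponents q (mulExponent b) (suc m + q)   ≡⟨ mulExponents-∏ q (mulExponent b) (suc m) ⟩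
  fromℕ P * (fromℕ (suc m) * b m)              ≡⟨ solve 3 (λ p m x → p :* (m :* x) := m :* p :* x) refl (fromℕ P) (fromℕ (suc m)) (b m) ⟩
  fromℕ (suc m) * fromℕ P * b m                ≡⟨ cong (_* b m) (fromℕ-* (suc m) P) ⟨
  fromℕ (suc m *ℕ P) * b m
    -- The factor for j = 0 is m + 1; the remaining ones are those of `P`, since m + (j + 2) = (m +
    -- 1) + (j + 1).
    ≡⟨ cong (λ x → fromℕ x * b m) (cong₂ _*ℕ_ (sym (ℕ.+-comm m 1)) (∏-cong q λ j → sym (ℕ.+-suc m (suc (toℕ j))))) ⟩
  fromℕ (∏[ j < suc q ] (m + suc (toℕ j))) * b m ∎
  where
  open ℚ.+-*-Solver
  P = ∏[ j < q ] (suc m + suc (toℕ j))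

-- Exponential series and the Bernoulli numbers.

1^n≡1 : ∀ n → 1ℚ ^ n ≡ 1ℚ
1^n≡1 zero    = refl
1^n≡1 (suc n) = trans (ℚ.*-identityˡ (1ℚ ^ n)) (1^n≡1 n)

exp-1 : ∀ n → exp 1ℚ n ≡ (+ 1 / n !) {{n ℕ.!≢0}}
exp-1 n = trans (cong (_* 1/n!) (1^n≡1 n)) (ℚ.*-identityˡ 1/n!)
  where 1/n! = (+ 1 / n !) {{n ℕ.!≢0}}

exp-0 : ∀ n → exp 0ℚ n ≡ 𝟙 n
exp-0 zero    = refl
exp-0 (suc n) = trans (cong (_* 1/[n+1]!) (ℚ.*-zeroˡ (0ℚ ^ n))) (ℚ.*-zeroˡ 1/[n+1]!)
  where 1/[n+1]! = (+ 1 / suc n !) {{suc n ℕ.!≢0}}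

-- Multiplication by e^z acts on exponential generating functions as the binomial transform, because
-- n!/(n - k)! = C(n, k) k!.
⊛-exp-1 : ∀ f n → fromℕ (n !) * (f ⊛ exp 1ℚ) n ≡ binomialSum (λ k → fromℕ (k !) * f k) n
⊛-exp-1 f n = trans
  (*-distribˡ-sum {suc n} (fromℕ (n !)) (λ k → f (toℕ k) * exp 1ℚ (n ∸ toℕ k)))
  (sum-cong-≗ {suc n} λ k → term (toℕ k) (toℕ≤pred[n] k))
  where
  open ℚ.+-*-Solver
  term : ∀ k → k ≤ n → fromℕ (n !) * (f k * exp 1ℚ (n ∸ k)) ≡ fromℕ (n C k) * (fromℕ (k !) * f k)
  term k k≤n = begin
    fromℕ (n !) * (f k * exp 1ℚ (n ∸ k))
      ≡⟨ cong (fromℕ (n !) *_) (trans (cong (f k *_) (exp-1 (n ∸ k))) (ℚ.*-comm (f k) r)) ⟩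
    fromℕ (n !) * (r * f k)
      ≡⟨ cong (λ x → fromℕ x * (r * f k)) (nCk*k![n∸k]!≡n! k≤n) ⟨
    fromℕ ((n C k) *ℕ (k ! *ℕ (n ∸ k) !)) * (r * f k)
      ≡⟨ cong (_* (r * f k)) (trans (fromℕ-* (n C k) (k ! *ℕ (n ∸ k) !))
           (cong (fromℕ (n C k) *_) (fromℕ-* (k !) ((n ∸ k) !)))) ⟩
    fromℕ (n C k) * (fromℕ (k !) * fromℕ ((n ∸ k) !)) * (r * f k)
      ≡⟨ solve 5 (λ a b c r x → a :* (b :* c) :* (r :* x) := c :* r :* (a :* (b :* x))) refl
           (fromℕ (n C k)) (fromℕ (k !)) (fromℕ ((n ∸ k) !)) r (f k) ⟩
    fromℕ ((n ∸ k) !) * r * (fromℕ (n C k) * (fromℕ (k !) * f k))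
      ≡⟨ cong (_* (fromℕ (n C k) * (fromℕ (k !) * f k))) (fromℕ-inverseʳ ((n ∸ k) !) {{(n ∸ k) ℕ.!≢0}}) ⟩
    1ℚ * (fromℕ (n C k) * (fromℕ (k !) * f k))
      ≡⟨ ℚ.*-identityˡ (fromℕ (n C k) * (fromℕ (k !) * f k)) ⟩
    fromℕ (n C k) * (fromℕ (k !) * f k) ∎
    where r = (+ 1 / (n ∸ k) !) {{(n ∸ k) ℕ.!≢0}}

bernoulli-coefficient : ∀ n → bernoulli n ≡ fromℕ (n !) * z/[e^z-1] n
bernoulli-coefficient n = cong (fromℕ (n !) *_) (begin
  (z/[e^z-1] ⊛ exp 0ℚ) n   ≡⟨ ⊛-comm z/[e^z-1] (exp 0ℚ) n ⟩
  (exp 0ℚ ⊛ z/[e^z-1]) n   ≡⟨ ⊛-congʳ z/[e^z-1] exp-0 n ⟩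
  (𝟙 ⊛ z/[e^z-1]) n        ≡⟨ ⊛-identityˡ z/[e^z-1] n ⟩
  z/[e^z-1] n              ∎)

-- With Q = z/(e^z - 1), this compares coefficients in e^z Q = (e^z - 1)Q + Q = z + Q.
binomialSum-bernoulli : ∀ n → binomialSum bernoulli n ≡ z n +ℚ bernoulli n
binomialSum-bernoulli n = begin
  binomialSum bernoulli n
    ≡⟨ binomialSum-cong bernoulli (λ k → fromℕ (k !) * z/[e^z-1] k) bernoulli-coefficient n ⟩
  binomialSum (λ k → fromℕ (k !) * z/[e^z-1] k) n          ≡⟨ ⊛-exp-1 z/[e^z-1] n ⟨
  fromℕ (n !) * (z/[e^z-1] ⊛ exp 1ℚ) n                     ≡⟨ cong (fromℕ (n !) *_) (⊛-comm z/[e^z-1] (exp 1ℚ) n) ⟩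
  fromℕ (n !) * (exp 1ℚ ⊛ z/[e^z-1]) n                     ≡⟨ cong (fromℕ (n !) *_) ([f⊖g]⊛h+g⊛h≡f⊛h z/[e^z-1] (exp 1ℚ) 𝟙 n) ⟨
  fromℕ (n !) * (((exp 1ℚ ⊖ 𝟙) ⊛ z/[e^z-1]) n +ℚ (𝟙 ⊛ z/[e^z-1]) n)
    ≡⟨ cong (fromℕ (n !) *_) (cong₂ _+ℚ_ (z/[e^z-1]-correct n) (⊛-identityˡ z/[e^z-1] n)) ⟩
  fromℕ (n !) * (z n +ℚ z/[e^z-1] n)                       ≡⟨ ℚ.*-distribˡ-+ (fromℕ (n !)) (z n) (z/[e^z-1] n) ⟩
  fromℕ (n !) * z n +ℚ fromℕ (n !) * z/[e^z-1] n           ≡⟨ cong₂ _+ℚ_ (n!*z n) (sym (bernoulli-coefficient n)) ⟩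
  z n +ℚ bernoulli n ∎
  where
  -- The only nonzero coefficient of z is in degree 1, where n! = 1.
  n!*z : ∀ n → fromℕ (n !) * z n ≡ z n
  n!*z 0             = refl
  n!*z 1             = refl
  n!*z (suc (suc n)) = ℚ.*-zeroʳ (fromℕ (suc (suc n) !))

sign-involutive : ∀ n x → sign n * (sign n * x) ≡ x
sign-involutive zero    x = trans (ℚ.*-identityˡ (1ℚ * x)) (ℚ.*-identityˡ x)
sign-involutive (suc n) x = trans (solve 2 (λ s x → :- s :* (:- s :* x) := s :* (s :* x)) refl (sign n) x)
  (sign-involutive n x)
  where open ℚ.+-*-Solver

-- The series z is odd.
sign-*-z : ∀ n → sign n * z n ≡ -ℚ z n
sign-*-z 0             = refl
sign-*-z 1             = refl
sign-*-z (suc (suc n)) = ℚ.*-zeroʳ (sign (suc (suc n)))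

-- Transposing ∑ₖ C(n,k) Bₖ = Bₙ + [n = 1] shows that the defect e is fixed by the
-- binomial transform, hence zero.
bernoulli-selfDual : SelfDual 1ℚ bernoulli
bernoulli-selfDual n = begin
  binomialSum bernoulli n       ≡⟨ sign-involutive n (binomialSum bernoulli n) ⟨
  sign n * c n                  ≡⟨ cong (sign n *_) (p-q≡0⇒p≡q (c n) (bernoulli n) (binomialSum-fixed⇒0 e fixed n)) ⟩
  sign n * bernoulli n          ≡⟨ ℚ.*-identityˡ (sign n * bernoulli n) ⟨
  1ℚ * (sign n * bernoulli n)   ∎
  where
  open ℚ.+-*-Solver
  -- `c` holds the moments of f ↦ L(f(-1 - x)), as (-1 - x)ⁿ = (-1)ⁿ(1 + x)ⁿ. The difference `e` is
  -- written with the factor `-ℚ 1ℚ` to suit `binomialSum-*ˡ`.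
  c e : ℕ → ℚ
  c n = sign n * binomialSum bernoulli n
  e n = c n +ℚ -ℚ 1ℚ * bernoulli n
  p-q≡0⇒p≡q : ∀ p q → p +ℚ -ℚ 1ℚ * q ≡ 0ℚ → p ≡ q
  p-q≡0⇒p≡q p q eq = trans (solve 2 (λ p q → p := (p :+ :- con 1ℚ :* q) :+ q) refl p q)
    (trans (cong (_+ℚ q) eq) (ℚ.+-identityˡ q))
  fixed : ∀ n → binomialSum e n ≡ e n
  fixed n = begin
    binomialSum e n
      ≡⟨ binomialSum-+ c (λ k → -ℚ 1ℚ * bernoulli k) n ⟩
    binomialSum c n +ℚ binomialSum (λ k → -ℚ 1ℚ * bernoulli k) n
      ≡⟨ cong₂ _+ℚ_
           -- The case i = 0 of the transposition is binomial inversion: the reflected functional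
           -- sends (1 + x)ⁿ to (-1)ⁿBₙ.
           (trans (binomialSum-transpose bernoulli c (λ _ → refl) 0 n)
             (cong (sign n *_) (trans (binomialSum-0 (λ k → bernoulli (n + k))) (cong bernoulli (ℕ.+-identityʳ n)))))
           (trans (binomialSum-*ˡ (-ℚ 1ℚ) bernoulli n) (cong (-ℚ 1ℚ *_) (binomialSum-bernoulli n))) ⟩
    sign n * bernoulli n +ℚ -ℚ 1ℚ * (z n +ℚ bernoulli n)
      ≡⟨ solve 3 (λ x y z → x :+ :- con 1ℚ :* (z :+ y) := (:- z :+ x) :+ :- con 1ℚ :* y) refl
           (sign n * bernoulli n) (bernoulli n) (z n) ⟩
    (-ℚ z n +ℚ sign n * bernoulli n) +ℚ -ℚ 1ℚ * bernoulli n
      -- Oddness of z lets the correction term carry the factor `sign n`, so that it recombines with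
      -- Bₙ into `c n`.
      ≡⟨ cong (λ x → (x +ℚ sign n * bernoulli n) +ℚ -ℚ 1ℚ * bernoulli n) (sign-*-z n) ⟨
    (sign n * z n +ℚ sign n * bernoulli n) +ℚ -ℚ 1ℚ * bernoulli n
      ≡⟨ cong (_+ℚ -ℚ 1ℚ * bernoulli n)
           (trans (sym (ℚ.*-distribˡ-+ (sign n) (z n) (bernoulli n))) (cong (sign n *_) (sym (binomialSum-bernoulli n)))) ⟩
    e n ∎

-- Vanishing on reflection-invariant polynomials.

x≡-x⇒x≡0 : ∀ x → x ≡ -ℚ x → x ≡ 0ℚ
x≡-x⇒x≡0 x x≡-x = fromℕ-cancelˡ 2 x (trans (solve 1 (λ x → con (fromℕ 2) :* x := x :+ x) refl x)
  (trans (cong (x +ℚ_) x≡-x) (ℚ.+-inverseʳ x)))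
  where open ℚ.+-*-Solver

-- At i = j = m the transposition has the same sum on both sides, with sign (-1)²ᵐ = 1. The
-- reflected functional is -L, so the sum equals its own negative.
antiSelfDual⇒0 : ∀ b → SelfDual (-ℚ 1ℚ) b → ∀ m → binomialSum (λ k → b (m + k)) m ≡ 0ℚ
antiSelfDual⇒0 b dual m = x≡-x⇒x≡0 x (begin
  x                                          ≡⟨ solve 1 (λ x → x := :- (:- con 1ℚ :* x)) refl x ⟩
  -ℚ (-ℚ 1ℚ * x)                             ≡⟨ cong -ℚ_ (binomialSum-*ˡ (-ℚ 1ℚ) (λ k → b (m + k)) m) ⟨
  -ℚ binomialSum (λ k → -ℚ 1ℚ * b (m + k)) m ≡⟨ cong -ℚ_ (binomialSum-transpose b (λ n → -ℚ 1ℚ * b n) -b≗ m m) ⟩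
  -ℚ (sign (m + m) * x)                      ≡⟨ cong (λ s → -ℚ (s * x)) (sign-square m) ⟩
  -ℚ (1ℚ * x)                                ≡⟨ cong -ℚ_ (ℚ.*-identityˡ x) ⟩
  -ℚ x                                       ∎)
  where
  open ℚ.+-*-Solver
  x = binomialSum (λ k → b (m + k)) m
  -- `dual` solved for b: the moments -b are those of the reflected functional, as the transposition
  -- requires.
  -b≗ : ∀ n → -ℚ 1ℚ * b n ≡ sign n * binomialSum b n
  -b≗ n = begin
    -ℚ 1ℚ * b n                            ≡⟨ sign-involutive n (-ℚ 1ℚ * b n) ⟨
    sign n * (sign n * (-ℚ 1ℚ * b n))
      ≡⟨ cong (sign n *_) (solve 2 (λ s x → s :* (:- con 1ℚ :* x) := :- con 1ℚ :* (s :* x)) refl (sign n) (b n)) ⟩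
    sign n * (-ℚ 1ℚ * (sign n * b n))      ≡⟨ cong (sign n *_) (dual n) ⟨
    sign n * binomialSum b n               ∎

theorem4p2 : (n q : ℕ) → 1 ≤ q → 2 ∤ q →
    ∑[ k ≤ n + q ]
    (fromℕ ((n + q) C toℕ k) * fromℕ (∏[ j < q ] (n + toℕ k + suc (toℕ j))) * bernoulli (n + toℕ k))
    ≡ 0ℚ
theorem4p2 n q _ 2∤q = trans (sum-cong-≗ {suc (n + q)} λ k → term (toℕ k)) (antiSelfDual⇒0 b dual (n + q))
  where
  b : ℕ → ℚ
  b = mulExponents q bernoulli
  dual : SelfDual (-ℚ 1ℚ) b
  -- L itself is invariant, and q differentiations contribute (-1)^q, which is -1 for odd q.
  dual = subst (λ ε → SelfDual ε b) (trans (ℚ.*-identityʳ (sign q)) (sign-odd q 2∤q))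
    (mulExponents-selfDual q 1ℚ bernoulli bernoulli-selfDual)
  term : ∀ k → fromℕ ((n + q) C k) * fromℕ (∏[ j < q ] (n + k + suc (toℕ j))) * bernoulli (n + k)
             ≡ fromℕ ((n + q) C k) * b (n + q + k)
  term k = begin
    fromℕ ((n + q) C k) * fromℕ P * bernoulli (n + k)     ≡⟨ ℚ.*-assoc (fromℕ ((n + q) C k)) (fromℕ P) (bernoulli (n + k)) ⟩
    fromℕ ((n + q) C k) * (fromℕ P * bernoulli (n + k))   ≡⟨ cong (fromℕ ((n + q) C k) *_) (mulExponents-∏ q bernoulli (n + k)) ⟨
    -- The product is absorbed into the moment of index n + k + q = N + k with N = n + q, so the sum
    -- becomes the value at xᴺ(1 + x)ᴺ.
    fromℕ ((n + q) C k) * b (n + k + q)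
      ≡⟨ cong (λ m → fromℕ ((n + q) C k) * b m)
           (trans (ℕ.+-assoc n k q) (trans (cong (_+_ n) (ℕ.+-comm k q)) (sym (ℕ.+-assoc n q k)))) ⟩
    fromℕ ((n + q) C k) * b (n + q + k)                   ∎
    where P = ∏[ j < q ] (n + k + suc (toℕ j))
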